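{- Let $n$ be a positive integer with $n \equiv 3 \pmod 6$ and \[n \notin \{9, 15, 21, 141, 153, 165, 177, 189, 231, 249, 261, 285, 351, 357\},\] and let $\rho$ be an integer with $1 \le \rho \le n/3$. Then there exists an $(n+\rho,4)$-packing with exactly $\rho n/3$ blocks in which the largest partial parallel class has size $\rho$.
   Context: For integers $v \ge k \ge 2$, a $(v,k)$-packing is a pair $(X,\mathcal{B})$ where $X$ is a set of $v$ points and $\mathcal{B}$ is a set of $k$-subsets of $X$ (blocks) such that every pair of distinct points lies in at most one block. A partial parallel class (PPC) is a set of pairwise disjoint blocks; its size is the number of blocks in it. "The largest PPC has size $\rho$" means that the packing contains a PPC of size $\rho$ but no PPC of size $\rho+1$. -}

module Defs where

open import Data.Fin using (Fin)
open import Data.Fin.Subset using (Subset; _∈_; _∩_; Empty; ∣_∣)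
open import Data.List using (List; length)
open import Data.List.Membership.Propositional using () renaming (_∈_ to _∈ₗ_)
open import Data.List.Relation.Unary.All using (All)
open import Data.List.Relation.Unary.AllPairs using (AllPairs)
open import Data.List.Relation.Unary.Unique.Propositional using (Unique)
open import Data.Nat using (ℕ; suc; _≤_)
open import Data.Product using (∃; _×_)
open import Relation.Binary.PropositionalEquality using (_≡_; _≢_)
open import Relation.Nullary using (¬_)

-- The point set is Fin v. Finite sets of blocks are represented by
-- duplicate-free lists, so that cardinality is length.
record Packing (v k : ℕ) : Set where
  field
    2≤k        : 2 ≤ k
    k≤v        : k ≤ v
    blocks     : List (Subset v)
    unique     : Unique blocks
    block-size : All (λ B → ∣ B ∣ ≡ k) blocks
    pair-once  : ∀ {x y : Fin v} → x ≢ y →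
                 ∀ {B C} → B ∈ₗ blocks → C ∈ₗ blocks →
                 x ∈ B → y ∈ B → x ∈ C → y ∈ C → B ≡ C

open Packing public using (blocks)

Disjoint : ∀ {v} → Subset v → Subset v → Set
Disjoint B C = Empty (B ∩ C)

record PPC {v k : ℕ} (P : Packing v k) : Set where
  field
    members  : List (Subset v)
    unique   : Unique members
    subset   : All (_∈ₗ blocks P) members
    disjoint : AllPairs Disjoint members

  size : ℕ
  size = length members

HasPPCOfSize : ∀ {v k} → Packing v k → ℕ → Set
HasPPCOfSize P s = ∃ λ (Q : PPC P) → PPC.size Q ≡ s

LargestPPCHasSize : ∀ {v k} → Packing v k → ℕ → Set
LargestPPCHasSize P ρ = HasPPCOfSize P ρ × ¬ HasPPCOfSize P (suc ρ)

{-# OPTIONS --safe #-}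

-- Write n = 3m with m odd.  It suffices to find m parallel classes of triples
-- on n points, no pair of points being covered twice, together with one block
-- from each class such that these m blocks are disjoint: take ρ of the classes
-- and add a new point ∞_c to every block of class c.  Each block then
-- contains exactly one of the ρ new points, so no PPC exceeds ρ blocks.
--
-- When m has a suitable transversal design TD(3, m), for instance
-- {c + d, c + 2d, c + 3d} over ℤ/m with gcd(m, 6) = 1, its classes (fixed c)
-- and the transversal d = 0 do the job.  Products with the plane over GF(9)
-- reach every m in which 3 has even exponent.  In the remaining case m = 3k,
-- every line of AG(2,3) is replaced by a TD(3, k).  This gives 4k classes;
-- labelling the TD classes on parallel lines with different cyclic shifts
-- makes 3k of them contain a common transversal, provided k ≥ 6.  The one
-- other case, m = 15, comes from a (15,4;1) difference matrix.
module Submission where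

open import Defs
open import Data.List using (List; []; _∷_; length)
open import Data.List.Membership.Propositional using (_∉_)
open import Data.Nat using (ℕ; _+_; _*_; _≤_; _/_; _%_)
open import Data.Product using (∃; _×_)
open import Relation.Binary.PropositionalEquality using (_≡_)

open import Data.Fin as Fin using (Fin; zero; suc; toℕ; fromℕ<; inject≤; _↑ˡ_; _↑ʳ_)
open import Data.Fin.Properties as Fin
  using (all?; toℕ-fromℕ<; toℕ-injective; toℕ<n; inject≤-injective; ↑ˡ-injective; ↑ʳ-injective;
         injective⇒≤; pigeonhole; *↔×)
open import Data.Fin.Subset as Subset using (Subset; inside; outside; ⁅_⁆; _∪_; ∣_∣)
open import Data.Fin.Subset.Properties
  using (x∈⁅x⁆; x∈⁅y⁆⇒x≡y; x∈p∪q⁺; x∈p∪q⁻; x∈p∩q⁺; x∈p∩q⁻; ∪-identityˡ; ∣⊥∣≡0; ∉⊥)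
open import Data.List using (map; allFin; lookup)
open import Data.List.Membership.Propositional using () renaming (_∈_ to _∈ₗ_)
open import Data.List.Membership.Propositional.Properties
  using (∈-map⁺; ∈-map⁻; ∈-allFin; ∈-lookup)
open import Data.List.Properties using (length-map; length-tabulate)
open import Data.List.Relation.Unary.All as All using ()
open import Data.List.Relation.Unary.All.Properties as All using ()
open import Data.List.Relation.Unary.AllPairs as AllPairs using (AllPairs; _∷_)
open import Data.List.Relation.Unary.AllPairs.Properties as AllPairs using ()
open import Data.List.Relation.Unary.Any using (here)
open import Data.List.Relation.Unary.Unique.Propositional.Properties as Unique using (allFin⁺)
open import Data.Nat using (zero; suc; _<_; _∸_; s≤s; s≤s⁻¹; NonZero; ∣_-_∣)
open import Data.Nat.Coprimality using (Coprime; 1-coprimeTo; coprime-divisor) renaming (sym to coprime-sym)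
open import Data.Nat.Divisibility
open import Data.Nat.DivMod
open import Data.Nat.Induction using (<-rec)
open import Data.Nat.Primality using (Prime; prime?; prime⇒irreducible)
open import Data.Nat.Properties
open import Data.Nat.Tactic.RingSolver using (solve-∀)
open import Data.Product using (_,_; proj₁; proj₂)
open import Data.Product.Properties using (≡-dec)
open import Data.Sum using (_⊎_; inj₁; inj₂)
open import Data.Vec as Vec using (Vec; []; _∷_)
open import Function using (_∘_; _↔_; Inverse; Injection)
open import Function.Construct.Composition using (_↔-∘_)
open import Function.Construct.Identity using (↔-id)
open import Function.Construct.Symmetry using (↔-sym)
open import Function.Properties.Inverse using (↔⇒↣)
open import Data.Product.Function.NonDependent.Propositional using (_×-↔_)
open import Relation.Binary using (DecidableEquality; tri<; tri≈; tri>)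
open import Relation.Binary.PropositionalEquality
  using (_≢_; refl; sym; trans; cong; cong₂; subst; subst₂; module ≡-Reasoning)
open import Relation.Nullary using (¬_; Dec; yes; no; contradiction)
open import Relation.Nullary.Decidable using (from-yes; map′; _→-dec_; _×-dec_; ¬?)
open import Relation.Unary using (Pred; Decidable)

-- Arithmetic modulo k

module _ {k : ℕ} .{{_ : NonZero k}} where

  -- The absolute difference stands in for the integer difference, so that cancellation modulo k
  -- becomes a question of divisibility inside ℕ.
  %≡⇒∣ : ∀ {a b} → a % k ≡ b % k → k ∣ ∣ a - b ∣
  %≡⇒∣ {a} {b} eq = subst (k ∣_) (sym lemma) (n∣m*n ∣ a / k - b / k ∣)
    where
    open ≡-Reasoning
    lemma : ∣ a - b ∣ ≡ ∣ a / k - b / k ∣ * k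
    lemma = begin
      ∣ a - b ∣
        ≡⟨ cong₂ ∣_-_∣ (m≡m%n+[m/n]*n a k) (trans (m≡m%n+[m/n]*n b k) (cong (_+ b / k * k) (sym eq))) ⟩
      ∣ a % k + a / k * k - a % k + b / k * k ∣
        ≡⟨ ∣m+n-m+o∣≡∣n-o∣ (a % k) _ _ ⟩
      ∣ a / k * k - b / k * k ∣
        ≡⟨ *-distribʳ-∣-∣ k (a / k) (b / k) ⟨
      ∣ a / k - b / k ∣ * k ∎

  ∣⇒%≡ : ∀ {a b} → k ∣ ∣ a - b ∣ → a % k ≡ b % k
  ∣⇒%≡ {a} {b} k∣ with ≤-total a b
  ... | inj₁ a≤b = sym (trans (cong (_% k) (sym (m+[n∸m]≡n a≤b)))
                     (%-remove-+ʳ a (subst (k ∣_) (m≤n⇒∣m-n∣≡n∸m a≤b) k∣)))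
  ... | inj₂ b≤a = trans (cong (_% k) (sym (m+[n∸m]≡n b≤a)))
                     (%-remove-+ʳ b (subst (k ∣_) (trans (∣-∣-comm a b) (m≤n⇒∣m-n∣≡n∸m b≤a)) k∣))

  +-cong-% : ∀ {a a′ b b′} → a % k ≡ a′ % k → b % k ≡ b′ % k → (a + b) % k ≡ (a′ + b′) % k
  +-cong-% {a} {a′} {b} {b′} p q = begin
    (a + b) % k             ≡⟨ %-distribˡ-+ a b k ⟩
    (a % k + b % k) % k     ≡⟨ cong₂ (λ x y → (x + y) % k) p q ⟩
    (a′ % k + b′ % k) % k   ≡⟨ %-distribˡ-+ a′ b′ k ⟨
    (a′ + b′) % k           ∎
    where open ≡-Reasoning

  +-cancelˡ-% : ∀ c {a b} → (c + a) % k ≡ (c + b) % k → a % k ≡ b % k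
  +-cancelˡ-% c {a} {b} eq = ∣⇒%≡ (subst (k ∣_) (∣m+n-m+o∣≡∣n-o∣ c a b) (%≡⇒∣ {c + a} {c + b} eq))

  +-cancelʳ-% : ∀ c {a b} → (a + c) % k ≡ (b + c) % k → a % k ≡ b % k
  +-cancelʳ-% c {a} {b} eq = +-cancelˡ-% c (subst₂ (λ x y → x % k ≡ y % k) (+-comm a c) (+-comm b c) eq)

  *-cancelˡ-% : ∀ c {a b} → Coprime k c → (c * a) % k ≡ (c * b) % k → a % k ≡ b % k
  *-cancelˡ-% c {a} {b} cop eq =
    ∣⇒%≡ (coprime-divisor cop (subst (k ∣_) (sym (*-distribˡ-∣-∣ c a b)) (%≡⇒∣ {c * a} {c * b} eq)))

  mod≡⇒%≡ : ∀ {a b} → a mod k ≡ b mod k → a % k ≡ b % k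
  mod≡⇒%≡ {a} {b} eq = trans (sym (toℕ-fromℕ< (m%n<n a k))) (trans (cong toℕ eq) (toℕ-fromℕ< (m%n<n b k)))

  toℕ-%-injective : {x y : Fin k} → toℕ x % k ≡ toℕ y % k → x ≡ y
  toℕ-%-injective {x} {y} eq =
    toℕ-injective (subst₂ _≡_ (m<n⇒m%n≡m (toℕ<n x)) (m<n⇒m%n≡m (toℕ<n y)) eq)

  toℕ-mod : (x : Fin k) → toℕ x mod k ≡ x
  toℕ-mod x = toℕ-injective (trans (toℕ-fromℕ< (m%n<n (toℕ x) k)) (m<n⇒m%n≡m (toℕ<n x)))

-- Uniqueness of division with remainder by a.
r+sa-injective : ∀ {a r r′ s s′} → r < a → r′ < a → r + s * a ≡ r′ + s′ * a → r ≡ r′ × s ≡ s′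
r+sa-injective {a@(suc _)} {r} {r′} {s} {s′} r<a r′<a eq = r≡ , s≡
  where
  r≡ : r ≡ r′
  r≡ = subst₂ _≡_ (trans ([m+kn]%n≡m%n r s a) (m<n⇒m%n≡m r<a))
                  (trans ([m+kn]%n≡m%n r′ s′ a) (m<n⇒m%n≡m r′<a)) (cong (_% a) eq)
  s≡ : s ≡ s′
  s≡ = *-cancelʳ-≡ s s′ a (+-cancelˡ-≡ r _ _ (trans eq (cong (_+ s′ * a) (sym r≡))))

prime∤⇒coprime : ∀ {p k} → Prime p → ¬ p ∣ k → Coprime k p
prime∤⇒coprime pp p∤k (d∣k , d∣p) with prime⇒irreducible pp d∣p
... | inj₁ d≡1  = d≡1
... | inj₂ refl = contradiction d∣k p∤k

-- Transversal designs

-- A resolvable TD(3, K).  Its blocks are indexed by c and d, the block meets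
-- group i in coord i c d, and the blocks with the same c form a parallel
-- class.  The blocks with d ≡ o are the triples {(0,c), (1,c), (2,c)}.
record ResolvableTD (K : Set) : Set where
  field
    coord           : Fin 3 → K → K → K
    o               : K
    idempotent      : ∀ i c → coord i c o ≡ c
    class-injective : ∀ {i c d d′} → coord i c d ≡ coord i c d′ → d ≡ d′
    linear-<        : ∀ {i j c d c′ d′} → i Fin.< j →
                      coord i c d ≡ coord i c′ d′ → coord j c d ≡ coord j c′ d′ → c ≡ c′ × d ≡ d′

  linear : ∀ {i j c d c′ d′} → i ≢ j →
           coord i c d ≡ coord i c′ d′ → coord j c d ≡ coord j c′ d′ → c ≡ c′ × d ≡ d′
  linear {i} {j} i≢j p q with Fin.<-cmp i j
  ... | tri< i<j _ _ = linear-< i<j p q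
  ... | tri≈ _ i≡j _ = contradiction i≡j i≢j
  ... | tri> _ _ j<i = linear-< j<i q p

_×-TD_ : ∀ {K L} → ResolvableTD K → ResolvableTD L → ResolvableTD (K × L)
S ×-TD T = record
  { coord           = λ i (c , x) (d , y) → S.coord i c d , T.coord i x y
  ; o               = S.o , T.o
  ; idempotent      = λ i (c , x) → cong₂ _,_ (S.idempotent i c) (T.idempotent i x)
  ; class-injective = λ p → cong₂ _,_ (S.class-injective (cong proj₁ p)) (T.class-injective (cong proj₂ p))
  ; linear-<        = λ i<j p q →
      let c≡ , d≡ = S.linear-< i<j (cong proj₁ p) (cong proj₁ q)
          x≡ , y≡ = T.linear-< i<j (cong proj₂ p) (cong proj₂ q)
      in cong₂ _,_ c≡ x≡ , cong₂ _,_ d≡ y≡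
  }
  where
  module S = ResolvableTD S
  module T = ResolvableTD T

transport-TD : ∀ {K L} → K ↔ L → ResolvableTD K → ResolvableTD L
transport-TD f T = record
  { coord           = λ i c d → to (coord i (from c) (from d))
  ; o               = to o
  ; idempotent      = λ i c → trans (cong (λ d → to (coord i (from c) d)) (strictlyInverseʳ o))
                                (trans (cong to (idempotent i (from c))) (strictlyInverseˡ c))
  ; class-injective = λ p → from-injective (class-injective (to-injective p))
  ; linear-<        = λ i<j p q → let c≡ , d≡ = linear-< i<j (to-injective p) (to-injective q)
                                  in from-injective c≡ , from-injective d≡
  }
  where
  open Inverse f
  open ResolvableTD T
  to-injective   = Injection.injective (↔⇒↣ f)
  from-injective = Injection.injective (↔⇒↣ (↔-sym f))

module _ {k : ℕ} .{{_ : NonZero k}} where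

  -- The r i are three rows of a cyclic (k,4;1) difference matrix whose fourth row is 0.
  differenceMatrix⇒TD : (r : Fin 3 → Fin k → ℕ) (o : Fin k) → (∀ i → r i o ≡ 0) →
    (∀ i d d′ → r i d % k ≡ r i d′ % k → d ≡ d′) →
    (∀ i j → i Fin.< j → ∀ d d′ → (r i d + r j d′) % k ≡ (r i d′ + r j d) % k → d ≡ d′) →
    ResolvableTD (Fin k)
  differenceMatrix⇒TD r o zeros row-injective difference-injective = record
    { coord           = λ i c d → (toℕ c + r i d) mod k
    ; o               = o
    ; idempotent      = λ i c → trans (cong (λ z → (toℕ c + z) mod k) (zeros i))
                                  (trans (cong (_mod k) (+-identityʳ (toℕ c))) (toℕ-mod c))
    ; class-injective = λ {i} {c} {d} {d′} p →
        row-injective i d d′ (+-cancelˡ-% (toℕ c) (mod≡⇒%≡ {a = toℕ c + r i d} {toℕ c + r i d′} p))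
    ; linear-<        = λ {i} {j} {c} {d} {c′} {d′} → linear {i} {j} {c} {d} {c′} {d′}
    }
    where
    linear : ∀ {i j c d c′ d′} → i Fin.< j →
      (toℕ c + r i d) mod k ≡ (toℕ c′ + r i d′) mod k →
      (toℕ c + r j d) mod k ≡ (toℕ c′ + r j d′) mod k → c ≡ c′ × d ≡ d′
    linear {i} {j} {c} {d} {c′} {d′} i<j p q = c≡ , d≡
      where
      regroup : ∀ u v x y → (u + x) + (v + y) ≡ (u + v) + (x + y)
      regroup = solve-∀
      regroup′ : ∀ u v x y → (v + x) + (u + y) ≡ (u + v) + (x + y)
      regroup′ = solve-∀
      P : (toℕ c + r i d) % k ≡ (toℕ c′ + r i d′) % k
      P = mod≡⇒%≡ {a = toℕ c + r i d} {toℕ c′ + r i d′} p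
      Q : (toℕ c′ + r j d′) % k ≡ (toℕ c + r j d) % k
      Q = sym (mod≡⇒%≡ {a = toℕ c + r j d} {toℕ c′ + r j d′} q)
      d≡ : d ≡ d′
      -- Adding `P` and `Q` puts c + c′ on both sides. What remains after cancelling it is the
      -- equality of the row differences r i - r j at d and d′, written without subtraction.
      d≡ = difference-injective i j i<j d d′ (+-cancelˡ-% (toℕ c + toℕ c′)
        (subst₂ (λ x y → x % k ≡ y % k)
          (regroup (toℕ c) (toℕ c′) (r i d) (r j d′)) (regroup′ (toℕ c) (toℕ c′) (r i d′) (r j d))
          (+-cong-% {k} {toℕ c + r i d} {toℕ c′ + r i d′} {toℕ c′ + r j d′} {toℕ c + r j d} P Q)))
      c≡ : c ≡ c′
      c≡ = toℕ-%-injective (+-cancelʳ-% (r i d)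
             (trans P (cong (λ z → (toℕ c′ + r i z) % k) (sym d≡))))

-- The rows are the multiples d, 2d, 3d. The multipliers 1, 2, 3 and their differences 1, 2, 1 are
-- all coprime to k, which is the difference matrix property.
coprime6-TD : ∀ {k} .{{_ : NonZero k}} → ¬ 2 ∣ k → ¬ 3 ∣ k → ResolvableTD (Fin k)
coprime6-TD {k@(suc _)} 2∤k 3∤k = differenceMatrix⇒TD (λ i d → suc (toℕ i) * toℕ d) zero
  (λ i → *-zeroʳ (suc (toℕ i)))
  (λ { zero d d′             → multiple-injective 1 coprime1
     ; (suc zero) d d′       → multiple-injective 2 coprime2
     ; (suc (suc zero)) d d′ → multiple-injective 3 coprime3 })
  (λ { zero (suc zero) _ d d′             → difference-injective 1 1 d d′ coprime1
     ; zero (suc (suc zero)) _ d d′       → difference-injective 1 2 d d′ coprime2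
     ; (suc zero) (suc zero) (s≤s ())
     ; (suc zero) (suc (suc zero)) _ d d′ → difference-injective 2 1 d d′ coprime1
     ; (suc (suc zero)) (suc zero) (s≤s ())
     ; (suc (suc zero)) (suc (suc zero)) (s≤s (s≤s ())) })
  where
  coprime1 : Coprime k 1
  coprime1 = coprime-sym (1-coprimeTo k)
  coprime2 : Coprime k 2
  coprime2 = prime∤⇒coprime (from-yes (prime? 2)) 2∤k
  coprime3 : Coprime k 3
  coprime3 = prime∤⇒coprime (from-yes (prime? 3)) 3∤k
  multiple-injective : ∀ α {d d′ : Fin k} → Coprime k α → (α * toℕ d) % k ≡ (α * toℕ d′) % k → d ≡ d′
  multiple-injective α cop eq = toℕ-%-injective (*-cancelˡ-% α cop eq)
  -- For the rows with multipliers α and γ + α: removing α(d + d′) from both sides leaves γd′ ≡ γd,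
  -- hence the `sym`.
  difference-injective : ∀ α γ (d d′ : Fin k) → Coprime k γ →
    (α * toℕ d + (γ + α) * toℕ d′) % k ≡ (α * toℕ d′ + (γ + α) * toℕ d) % k → d ≡ d′
  difference-injective α γ d d′ cop eq = sym (multiple-injective γ cop
    (+-cancelˡ-% (α * toℕ d + α * toℕ d′)
      (subst₂ (λ x y → x % k ≡ y % k)
        (left α γ (toℕ d) (toℕ d′)) (right α γ (toℕ d) (toℕ d′)) eq)))
    where
    left : ∀ α γ x y → α * x + (γ + α) * y ≡ (α * x + α * y) + γ * y
    left = solve-∀
    right : ∀ α γ x y → α * y + (γ + α) * x ≡ (α * x + α * y) + γ * x
    right = solve-∀

Fin3²-all? : ∀ {p} {P : Pred (Fin 3 × Fin 3) p} → Decidable P → Dec (∀ x → P x)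
Fin3²-all? P? = map′ (λ h (a , b) → h a b) (λ h a b → h (a , b)) (all? λ a → all? λ b → P? (a , b))

infix 4 _≟²_
_≟²_ : DecidableEquality (Fin 3 × Fin 3)
_≟²_ = ≡-dec Fin._≟_ Fin._≟_

-- Here (a , b) stands for a + bι with ι² = −1; the blocks are
-- {c + d, c + 2d, c + ιd}.
GF9-TD : ResolvableTD (Fin 3 × Fin 3)
GF9-TD = record
  { coord           = coord
  ; o               = zero , zero
  ; idempotent      = from-yes (all? λ i → Fin3²-all? λ c → coord i c (zero , zero) ≟² c)
  ; class-injective = λ {i} {c} {d} {d′} → class-injective i c d d′
  ; linear-<        = λ {i} {j} {c} {d} {c′} {d′} i<j → linear i j i<j c d c′ d′
  }
  where
  add : Fin 3 × Fin 3 → Fin 3 × Fin 3 → Fin 3 × Fin 3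
  add (a , b) (a′ , b′) = (toℕ a + toℕ a′) mod 3 , (toℕ b + toℕ b′) mod 3
  multiple : Fin 3 → Fin 3 × Fin 3 → Fin 3 × Fin 3
  multiple zero             d       = d
  multiple (suc zero)       d       = add d d
  -- Multiplication by ι: ι(a + bι) = -b + aι, and -b = 2b modulo 3.
  multiple (suc (suc zero)) (a , b) = (2 * toℕ b) mod 3 , a
  coord : Fin 3 → Fin 3 × Fin 3 → Fin 3 × Fin 3 → Fin 3 × Fin 3
  coord i c d = add c (multiple i d)
  class-injective : ∀ i c d d′ → coord i c d ≡ coord i c d′ → d ≡ d′
  class-injective = from-yes (all? λ i → Fin3²-all? λ c → Fin3²-all? λ d → Fin3²-all? λ d′ →
    (coord i c d ≟² coord i c d′) →-dec (d ≟² d′))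
  linear : ∀ i j → i Fin.< j → ∀ c d c′ d′ →
    coord i c d ≡ coord i c′ d′ → coord j c d ≡ coord j c′ d′ → c ≡ c′ × d ≡ d′
  linear = from-yes (all? λ i → all? λ j → (i Fin.<? j) →-dec
    (Fin3²-all? λ c → Fin3²-all? λ d → Fin3²-all? λ c′ → Fin3²-all? λ d′ →
      (coord i c d ≟² coord i c′ d′) →-dec ((coord j c d ≟² coord j c′ d′) →-dec
        ((c ≟² c′) ×-dec (d ≟² d′)))))

-- Three of the four nonconstant rows of the (15,5;1) difference matrix of
-- Schellenberg, van Rees and Vanstone.
TD15 : ResolvableTD (Fin 15)
TD15 = differenceMatrix⇒TD r zero
  (from-yes (all? λ i → r i zero ≟ 0))
  (from-yes (all? λ i → all? λ d → all? λ d′ → (r i d % 15 ≟ r i d′ % 15) →-dec (d Fin.≟ d′)))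
  (from-yes (all? λ i → all? λ j → (i Fin.<? j) →-dec (all? λ d → all? λ d′ →
    ((r i d + r j d′) % 15 ≟ (r i d′ + r j d) % 15) →-dec (d Fin.≟ d′))))
  where
  rows : Vec (Vec ℕ 15) 3
  rows = (0 ∷ 1 ∷ 2 ∷ 3  ∷ 4  ∷ 5  ∷ 6 ∷ 7  ∷ 8  ∷ 9  ∷ 10 ∷ 11 ∷ 12 ∷ 13 ∷ 14 ∷ [])
       ∷ (0 ∷ 2 ∷ 5 ∷ 7  ∷ 9  ∷ 12 ∷ 4 ∷ 1  ∷ 14 ∷ 11 ∷ 3  ∷ 6  ∷ 8  ∷ 10 ∷ 13 ∷ [])
       ∷ (0 ∷ 6 ∷ 3 ∷ 14 ∷ 10 ∷ 7  ∷ 13 ∷ 4 ∷ 11 ∷ 2  ∷ 8  ∷ 5  ∷ 1  ∷ 12 ∷ 9  ∷ [])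
       ∷ []
  r : Fin 3 → Fin 15 → ℕ
  r i = Vec.lookup (Vec.lookup rows i)

-- Strong induction, removing one factor 3 at a time. Each such factor switches between the two
-- alternatives, and a second one is absorbed together with the first by a product with `GF9-TD`.
odd⇒TD : ∀ m → ¬ 2 ∣ m → ResolvableTD (Fin m) ⊎ ∃ λ k → m ≡ 3 * k × ResolvableTD (Fin k)
odd⇒TD = <-rec _ step
  where
  step : ∀ m → (∀ {l} → l < m → ¬ 2 ∣ l → ResolvableTD (Fin l) ⊎ ∃ λ k → l ≡ 3 * k × ResolvableTD (Fin k)) →
    ¬ 2 ∣ m → ResolvableTD (Fin m) ⊎ ∃ λ k → m ≡ 3 * k × ResolvableTD (Fin k)
  step zero      rec 2∤m = contradiction (2 ∣0) 2∤m
  step m@(suc _) rec 2∤m with 3 ∣? m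
  ... | no 3∤m                    = inj₁ (coprime6-TD 2∤m 3∤m)
  ... | yes 3∣m@(divides l m≡l*3) with rec (quotient-< 3∣m) (λ 2∣l → 2∤m (∣-trans 2∣l (quotient-∣ 3∣m)))
  ...   | inj₁ T                 = inj₂ (l , trans m≡l*3 (*-comm l 3) , T)
  ...   | inj₂ (k , l≡3*k , T)   = inj₁ (subst (ResolvableTD ∘ Fin) (sym m≡9*k)
                                    (transport-TD (↔-sym *↔×) (transport-TD (↔-sym *↔×) GF9-TD ×-TD T)))
    where
    m≡9*k : m ≡ 9 * k
    m≡9*k = trans m≡l*3 (trans (cong (_* 3) l≡3*k) (trans (*-comm (3 * k) 3) (sym (*-assoc 3 3 k))))

-- Resolvable triple systems

-- `point c b l` is the point at position l of block b in class c. It is enough that `linear` yields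
-- `c ≡ c′`, since `class-injective` then identifies the blocks.
record Resolvable (P C B : Set) : Set where
  field
    point           : C → B → Fin 3 → P
    class-injective : ∀ {c b b′ l l′} → point c b l ≡ point c b′ l′ → b ≡ b′ × l ≡ l′
    linear          : ∀ {c b c′ b′ l m l′ m′} → l ≢ m →
                      point c b l ≡ point c′ b′ l′ → point c b m ≡ point c′ b′ m′ → c ≡ c′

record ResolvableWithTransversal (P C B : Set) : Set where
  field
    resolvable : Resolvable P C B
  open Resolvable resolvable public
  field
    transversal           : C → B
    transversal-injective : ∀ {c c′ l l′} → point c (transversal c) l ≡ point c′ (transversal c′) l′ → c ≡ c′

transport-Resolvable : ∀ {P C B P′ C′ B′} → P ↔ P′ → C ↔ C′ → B ↔ B′ →
  ResolvableWithTransversal P C B → ResolvableWithTransversal P′ C′ B′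
transport-Resolvable f g h R = record
  { resolvable = record
    { point           = λ c b l → P.to (point (C.from c) (B.from b) l)
    ; class-injective = λ p → let b≡ , l≡ = class-injective (P-injective p) in B-injective b≡ , l≡
    ; linear          = λ l≢m p q → C-injective (linear l≢m (P-injective p) (P-injective q))
    }
  ; transversal           = λ c → B.to (transversal (C.from c))
  ; transversal-injective = λ {c} {c′} {l} {l′} p → C-injective (transversal-injective
      (subst₂ (λ b b′ → point (C.from c) b l ≡ point (C.from c′) b′ l′)
        (B.strictlyInverseʳ _) (B.strictlyInverseʳ _) (P-injective p)))
  }
  where
  open ResolvableWithTransversal R
  module P = Inverse f
  module C = Inverse g
  module B = Inverse h
  P-injective = Injection.injective (↔⇒↣ f)
  C-injective = Injection.injective (↔⇒↣ (↔-sym g))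
  B-injective = Injection.injective (↔⇒↣ (↔-sym h))

-- The degenerate base geometry, whose blow-up is the transversal design itself.
single-line : Resolvable (Fin 3) (Fin 1) (Fin 1)
single-line = record
  { point           = λ _ _ l → l
  ; class-injective = λ { {b = zero} {zero} l≡l′ → refl , l≡l′ }
  ; linear          = λ { {c = zero} {c′ = zero} _ _ _ → refl }
  }

-- Class zero consists of the vertical lines, class suc s of the lines of slope s.
AG23 : Resolvable (Fin 3 × Fin 3) (Fin 4) (Fin 3)
AG23 = record
  { point           = point
  ; class-injective = λ {i} {j} {j′} {l} {l′} → class-injective i j j′ l l′
  ; linear          = λ {i} {j} {i′} {j′} {l} {m} {l′} {m′} → linear i j i′ j′ l m l′ m′
  }
  where
  point : Fin 4 → Fin 3 → Fin 3 → Fin 3 × Fin 3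
  point zero    j l = j , l
  point (suc s) j l = l , (toℕ j + toℕ s * toℕ l) mod 3
  class-injective : ∀ i j j′ l l′ → point i j l ≡ point i j′ l′ → j ≡ j′ × l ≡ l′
  class-injective = from-yes (all? λ i → all? λ j → all? λ j′ → all? λ l → all? λ l′ →
    (point i j l ≟² point i j′ l′) →-dec ((j Fin.≟ j′) ×-dec (l Fin.≟ l′)))
  linear : ∀ i j i′ j′ l m l′ m′ → l ≢ m →
    point i j l ≡ point i′ j′ l′ → point i j m ≡ point i′ j′ m′ → i ≡ i′
  linear = from-yes (all? λ i → all? λ j → all? λ i′ → all? λ j′ → all? λ l → all? λ m → all? λ l′ → all? λ m′ →
    ¬? (l Fin.≟ m) →-dec
    ((point i j l ≟² point i′ j′ l′) →-dec ((point i j m ≟² point i′ j′ m′) →-dec (i Fin.≟ i′))))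

-- Replace line j of class i by a TD on k copies of its points.  The interval
-- [ia, (i+1)a) of ℤ/k is assigned to class i; its element x, together with
-- s < L, yields the parallel class consisting of the TD classes
-- x + sa − ja on the lines j.  Since La ≤ k these are distinct for fixed i and
-- j.  The transversal takes from line s the triple {x} × line, and these
-- triples cover every x at every point because the intervals partition ℤ/k.
-- The shift −ja is written (L − j)a, which changes all x by La.
module BlowUp {Q : Set} {I L a k : ℕ} .{{_ : NonZero a}} .{{_ : NonZero k}}
              (G : Resolvable Q (Fin I) (Fin L)) (T : ResolvableTD (Fin k))
              (La≤k : L * a ≤ k) (k≤Ia : k ≤ I * a) where

  private
    module G = Resolvable G
    module T = ResolvableTD T

  part : Fin k → Fin I
  part x = fromℕ< (m<n*o⇒m/o<n (<-≤-trans (toℕ<n x) k≤Ia))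

  part≡⇒/≡ : ∀ {x x′} → part x ≡ part x′ → toℕ x / a ≡ toℕ x′ / a
  part≡⇒/≡ eq = trans (sym (toℕ-fromℕ< _)) (trans (cong toℕ eq) (toℕ-fromℕ< _))

  shift : Fin L → Fin L → Fin k → Fin k
  shift s j x = (toℕ x + (toℕ s * a + (L ∸ toℕ j) * a)) mod k

  -- Split x into (x / a)a and x % a. The quotient is fixed by `part` and cancels along with the
  -- shift of line j. The rest, x % a + sa, lies below La ≤ k, so the congruence is an equality and
  -- division by a recovers both x % a and s.
  shift-injective : ∀ {s s′ j x x′} → part x ≡ part x′ → shift s j x ≡ shift s′ j x′ → s ≡ s′ × x ≡ x′
  shift-injective {s} {s′} {j} {x} {x′} part≡ eq = toℕ-injective (proj₂ rs≡) , toℕ-injective x≡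
    where
    t = (L ∸ toℕ j) * a
    x/a≡ = part≡⇒/≡ part≡
    rearrange : ∀ (y : Fin k) (s : Fin L) →
      toℕ y + (toℕ s * a + t) ≡ (toℕ y / a * a + t) + (toℕ y % a + toℕ s * a)
    rearrange y s = trans (cong (_+ (toℕ s * a + t)) (m≡m%n+[m/n]*n (toℕ y) a)) (swap (toℕ y % a) (toℕ y / a * a) _ t)
      where
      swap : ∀ r q u t → (r + q) + (u + t) ≡ (q + t) + (r + u)
      swap = solve-∀
    small : ∀ (y : Fin k) (s : Fin L) → toℕ y % a + toℕ s * a < k
    small y s = <-≤-trans (+-monoˡ-< (toℕ s * a) (m%n<n (toℕ y) a))
                          (≤-trans (*-monoˡ-≤ a (toℕ<n s)) La≤k)
    cancelled : (toℕ x % a + toℕ s * a) % k ≡ (toℕ x′ % a + toℕ s′ * a) % k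
    cancelled = +-cancelˡ-% (toℕ x / a * a + t)
      (subst₂ (λ y z → y % k ≡ z % k) (rearrange x s)
        (trans (rearrange x′ s′) (cong (λ q → (q * a + t) + (toℕ x′ % a + toℕ s′ * a)) (sym x/a≡)))
        (mod≡⇒%≡ {a = toℕ x + (toℕ s * a + t)} {toℕ x′ + (toℕ s′ * a + t)} eq))
    rs≡ : toℕ x % a ≡ toℕ x′ % a × toℕ s ≡ toℕ s′
    rs≡ = r+sa-injective (m%n<n (toℕ x) a) (m%n<n (toℕ x′) a)
            (subst₂ _≡_ (m<n⇒m%n≡m (small x s)) (m<n⇒m%n≡m (small x′ s′)) cancelled)
    x≡ : toℕ x ≡ toℕ x′
    x≡ = trans (m≡m%n+[m/n]*n (toℕ x) a)
           (trans (cong₂ (λ r q → r + q * a) (proj₁ rs≡) x/a≡) (sym (m≡m%n+[m/n]*n (toℕ x′) a)))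

  -- For j = s the two shifts add up to La whatever s is, so x undergoes one fixed translation.
  shift-diagonal-injective : ∀ {s s′ x x′} → shift s s x ≡ shift s′ s′ x′ → x ≡ x′
  shift-diagonal-injective {s} {s′} {x} {x′} eq = toℕ-%-injective (+-cancelʳ-% (L * a)
    (subst₂ (λ u v → (toℕ x + u) % k ≡ (toℕ x′ + v) % k) (total s) (total s′)
      (mod≡⇒%≡ {a = toℕ x + (toℕ s * a + (L ∸ toℕ s) * a)} {toℕ x′ + (toℕ s′ * a + (L ∸ toℕ s′) * a)} eq)))
    where
    total : ∀ (s : Fin L) → toℕ s * a + (L ∸ toℕ s) * a ≡ L * a
    total s = trans (sym (*-distribʳ-+ a (toℕ s) (L ∸ toℕ s))) (cong (_* a) (m+[n∸m]≡n (<⇒≤ (toℕ<n s))))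

  point : Fin L × Fin k → Fin L × Fin k → Fin 3 → Q × Fin k
  point (s , x) (j , d) l = G.point (part x) j l , T.coord l (shift s j x) d

  blowUp : ResolvableWithTransversal (Q × Fin k) (Fin L × Fin k) (Fin L × Fin k)
  blowUp = record
    { resolvable = record
      { point           = point
      ; class-injective = λ {c} {b} {b′} {l} {l′} → class-injective {c} {b} {b′} {l} {l′}
      ; linear          = λ {c} {b} {c′} {b′} {l} {m} {l′} {m′} → linear {c} {b} {c′} {b′} {l} {m} {l′} {m′}
      }
    ; transversal           = λ (s , x) → s , T.o
    ; transversal-injective = λ {c} {c′} {l} {l′} → transversal-injective {c} {c′} {l} {l′}
    }
    where
    class-injective : ∀ {c b b′ l l′} → point c b l ≡ point c b′ l′ → b ≡ b′ × l ≡ l′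
    class-injective p with refl , refl ← G.class-injective (cong proj₁ p) =
      cong (_ ,_) (T.class-injective (cong proj₂ p)) , refl

    linear : ∀ {c b c′ b′ l m l′ m′} → l ≢ m →
             point c b l ≡ point c′ b′ l′ → point c b m ≡ point c′ b′ m′ → c ≡ c′
    linear {s , x} {j , d} {s′ , x′} {j′ , d′} {l} {m} {l′} {m′} l≢m p q = cong₂ _,_ (proj₁ sx≡) (proj₂ sx≡)
      where
      -- Projection to the base identifies first the class, then the line and both positions. Only
      -- then do the second coordinates lie in the same two groups, so that `T.linear` identifies
      -- the TD class.
      part≡ : part x ≡ part x′
      part≡ = G.linear l≢m (cong proj₁ p) (cong proj₁ q)
      jl≡ : j ≡ j′ × l ≡ l′
      jl≡ = G.class-injective (trans (cong proj₁ p) (cong (λ i → G.point i j′ l′) (sym part≡)))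
      jm≡ : j ≡ j′ × m ≡ m′
      jm≡ = G.class-injective (trans (cong proj₁ q) (cong (λ i → G.point i j′ m′) (sym part≡)))
      shift≡ : shift s j x ≡ shift s′ j′ x′
      shift≡ = proj₁ (T.linear l≢m
        (trans (cong proj₂ p) (cong (λ l → T.coord l (shift s′ j′ x′) d′) (sym (proj₂ jl≡))))
        (trans (cong proj₂ q) (cong (λ m → T.coord m (shift s′ j′ x′) d′) (sym (proj₂ jm≡)))))
      sx≡ : s ≡ s′ × x ≡ x′
      sx≡ = shift-injective {j = j} part≡ (trans shift≡ (cong (λ j → shift s′ j x′) (sym (proj₁ jl≡))))

    -- By `idempotent` every point of a chosen block has second coordinate `shift s s x`, which
    -- determines x. Then both base lines belong to class `part x`, and a common point forces them
    -- to be equal.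
    transversal-injective : ∀ {c c′ l l′} →
      point c (proj₁ c , T.o) l ≡ point c′ (proj₁ c′ , T.o) l′ → c ≡ c′
    transversal-injective {s , x} {s′ , x′} {l} {l′} p
      with refl ← shift-diagonal-injective {s} {s′} {x} {x′}
             (trans (sym (T.idempotent l _)) (trans (cong proj₂ p) (T.idempotent l′ _)))
      = cong (_, x) (proj₁ (G.class-injective (cong proj₁ p)))

  blowUp-Fin : Q ↔ Fin (3 * L) → ∀ {m} → L * k ≡ m → ResolvableWithTransversal (Fin (3 * m)) (Fin m) (Fin m)
  blowUp-Fin Q↔ refl =
    subst (λ n → ResolvableWithTransversal (Fin n) (Fin (L * k)) (Fin (L * k))) (*-assoc 3 L k)
      (transport-Resolvable (↔-sym *↔× ↔-∘ (Q↔ ×-↔ ↔-id (Fin k))) (↔-sym *↔×) (↔-sym *↔×) blowUp)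

-- Existence for odd m other than 3

TD⇒resolvable : ∀ {m} .{{_ : NonZero m}} → ResolvableTD (Fin m) → ResolvableWithTransversal (Fin (3 * m)) (Fin m) (Fin m)
-- One interval of length a = m covers ℤ/m, and the only shift is by m, which is trivial.
TD⇒resolvable {m} T = BlowUp.blowUp-Fin {a = m} single-line T (≤-reflexive 1*m≡m) (≤-reflexive (sym 1*m≡m)) (↔-id (Fin 3)) 1*m≡m
  where
  1*m≡m = *-identityˡ m

-- Interval lengths for the blow-up of AG(2,3), with L = 3 lines in each of I = 4 classes. Raising k
-- by 4 raises the length by 1. The start is 6 because k = 5 admits no length.
quarter : ∀ t → ∃ λ a → 3 * suc a ≤ 6 + t × 6 + t ≤ 4 * suc a
quarter 0 = 1 , from-yes (6 ≤? 6) , from-yes (6 ≤? 8)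
quarter 1 = 1 , from-yes (6 ≤? 7) , from-yes (7 ≤? 8)
quarter 2 = 1 , from-yes (6 ≤? 8) , from-yes (8 ≤? 8)
quarter 3 = 2 , from-yes (9 ≤? 9) , from-yes (9 ≤? 12)
quarter (suc (suc (suc (suc t)))) with a , 3a≤ , ≤4a ← quarter t =
  suc a ,
  subst₂ _≤_ (sym (*-suc 3 (suc a))) (+-assoc 4 6 t) (+-mono-≤ (from-yes (3 ≤? 4)) 3a≤) ,
  subst₂ _≤_ (+-assoc 4 6 t) (sym (*-suc 4 (suc a))) (+-monoʳ-≤ 4 ≤4a)

odd⇒resolvable : ∀ m → ¬ 2 ∣ m → m ≢ 3 → ResolvableWithTransversal (Fin (3 * m)) (Fin m) (Fin m)
odd⇒resolvable zero      2∤m m≢3 = contradiction (2 ∣0) 2∤m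
odd⇒resolvable m@(suc _) 2∤m m≢3 with odd⇒TD m 2∤m
... | inj₁ T = TD⇒resolvable T
... | inj₂ (k , m≡3*k , T) = threefold k m≡3*k T
  where
  threefold : ∀ k → m ≡ 3 * k → ResolvableTD (Fin k) → ResolvableWithTransversal (Fin (3 * m)) (Fin m) (Fin m)
  -- The odd values of k below 6 are 1, which is excluded, and 3 and 5, where a TD of order m = 9 or
  -- m = 15 is used directly.
  threefold 0 m≡ T = contradiction (divides 0 m≡) 2∤m
  threefold 1 m≡ T = contradiction m≡ m≢3
  threefold 2 m≡ T = contradiction (divides 3 m≡) 2∤m
  threefold 3 refl T = TD⇒resolvable (transport-TD (↔-sym *↔×) GF9-TD)
  threefold 4 m≡ T = contradiction (divides 6 m≡) 2∤m
  threefold 5 refl T = TD⇒resolvable TD15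
  threefold (suc (suc (suc (suc (suc (suc t)))))) m≡ T with a , 3a≤k , k≤4a ← quarter t =
    BlowUp.blowUp-Fin {a = suc a} AG23 T 3a≤k k≤4a (↔-sym *↔×) (sym m≡)

-- Packings

∣⁅x⁆∪p∣ : ∀ {v} {x : Fin v} {p : Subset v} → x Subset.∉ p → ∣ ⁅ x ⁆ ∪ p ∣ ≡ suc ∣ p ∣
∣⁅x⁆∪p∣ {x = zero}  {inside ∷ p}  x∉p = contradiction Vec.here x∉p
∣⁅x⁆∪p∣ {x = zero}  {outside ∷ p} x∉p = cong (suc ∘ ∣_∣) (∪-identityˡ p)
∣⁅x⁆∪p∣ {x = suc x} {inside ∷ p}  x∉p = cong suc (∣⁅x⁆∪p∣ (x∉p ∘ Vec.there))
∣⁅x⁆∪p∣ {x = suc x} {outside ∷ p} x∉p = ∣⁅x⁆∪p∣ (x∉p ∘ Vec.there)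

image : ∀ {k v} → (Fin k → Fin v) → Subset v
image {zero}  f = Subset.⊥
image {suc k} f = ⁅ f zero ⁆ ∪ image (f ∘ suc)

∈-image⁺ : ∀ {k v} (f : Fin k → Fin v) i → f i Subset.∈ image f
∈-image⁺ f zero    = x∈p∪q⁺ (inj₁ (x∈⁅x⁆ (f zero)))
∈-image⁺ f (suc i) = x∈p∪q⁺ (inj₂ (∈-image⁺ (f ∘ suc) i))

∈-image⁻ : ∀ {k v} (f : Fin k → Fin v) {x} → x Subset.∈ image f → ∃ λ i → x ≡ f i
∈-image⁻ {zero}  f x∈ = contradiction x∈ ∉⊥
∈-image⁻ {suc k} f x∈ with x∈p∪q⁻ ⁅ f zero ⁆ _ x∈
... | inj₁ x∈f0 = zero , x∈⁅y⁆⇒x≡y _ x∈f0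
... | inj₂ x∈fs = let i , x≡ = ∈-image⁻ (f ∘ suc) x∈fs in suc i , x≡

∣image∣ : ∀ {k v} (f : Fin k → Fin v) → (∀ {i j} → f i ≡ f j → i ≡ j) → ∣ image f ∣ ≡ k
∣image∣ {zero} {v} f inj = ∣⊥∣≡0 v
∣image∣ {suc k}    f inj = trans (∣⁅x⁆∪p∣ f0∉) (cong suc (∣image∣ (f ∘ suc) (Fin.suc-injective ∘ inj)))
  where
  f0∉ : f zero Subset.∉ image (f ∘ suc)
  f0∉ f0∈ with i , eq ← ∈-image⁻ (f ∘ suc) f0∈ = contradiction (inj eq) λ()

module LinearSpace {N k v : ℕ} (f : Fin N → Fin k → Fin v) (2≤k : 2 ≤ k) (k≤v : k ≤ v)
  (injective : ∀ e {i j} → f e i ≡ f e j → i ≡ j)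
  (linear : ∀ {e e′ i j i′ j′} → i ≢ j → f e i ≡ f e′ i′ → f e j ≡ f e′ j′ → e ≡ e′) where

  block : Fin N → Subset v
  block = image ∘ f

  common-points⇒≡ : ∀ {e e′ x y} → x ≢ y → x Subset.∈ block e → y Subset.∈ block e →
                    x Subset.∈ block e′ → y Subset.∈ block e′ → e ≡ e′
  common-points⇒≡ {e} {e′} x≢y x∈e y∈e x∈e′ y∈e′
    with i , refl ← ∈-image⁻ (f e) x∈e | j , refl ← ∈-image⁻ (f e) y∈e
    = linear (x≢y ∘ cong (f e)) (proj₂ (∈-image⁻ (f e′) x∈e′)) (proj₂ (∈-image⁻ (f e′) y∈e′))

  -- As k ≥ 2, a block has two distinct points, and these determine its index. Hence the number of
  -- blocks is N.
  block-injective : ∀ {e e′} → block e ≡ block e′ → e ≡ e′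
  block-injective {e} {e′} eq = common-points⇒≡ {e} {e′} (i₀≢i₁ ∘ injective e)
      (∈-image⁺ (f e) i₀) (∈-image⁺ (f e) i₁)
      (subst (f e i₀ Subset.∈_) eq (∈-image⁺ (f e) i₀)) (subst (f e i₁ Subset.∈_) eq (∈-image⁺ (f e) i₁))
    where
    i₀ i₁ : Fin k
    i₀ = inject≤ zero 2≤k
    i₁ = inject≤ (suc zero) 2≤k
    i₀≢i₁ : i₀ ≢ i₁
    i₀≢i₁ eq = contradiction (inject≤-injective 2≤k 2≤k _ _ eq) λ()

  packing : Packing v k
  packing = record
    { 2≤k        = 2≤k
    ; k≤v        = k≤v
    ; blocks     = map block (allFin N)
    ; unique     = Unique.map⁺ block-injective (allFin⁺ N)
    ; block-size = All.map⁺ (All.universal (λ e → ∣image∣ (f e) (injective e)) (allFin N))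
    ; pair-once  = pair-once
    }
    where
    pair-once : ∀ {x y} → x ≢ y → ∀ {B C} → B ∈ₗ map block (allFin N) → C ∈ₗ map block (allFin N) →
                x Subset.∈ B → y Subset.∈ B → x Subset.∈ C → y Subset.∈ C → B ≡ C
    pair-once x≢y B∈ C∈ xB yB xC yC
      with e , _ , refl ← ∈-map⁻ block B∈ | e′ , _ , refl ← ∈-map⁻ block C∈
      = cong block (common-points⇒≡ x≢y xB yB xC yC)

AllPairs-lookup : ∀ {a r} {A : Set a} {R : A → A → Set r} {xs} → AllPairs R xs →
                  ∀ {i j} → i Fin.< j → R (lookup xs i) (lookup xs j)
AllPairs-lookup (Rx ∷ _)  {zero}  {suc j} _   = All.lookup Rx (∈-lookup j)
AllPairs-lookup (_ ∷ Rxs) {suc i} {suc j} i<j = AllPairs-lookup Rxs (s≤s⁻¹ i<j)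

-- Adding a new point to each of ρ parallel classes

module Completion {n m ρ : ℕ} (R : ResolvableWithTransversal (Fin n) (Fin m) (Fin m))
                  (1≤ρ : 1 ≤ ρ) (ρ≤m : ρ ≤ m) where

  open ResolvableWithTransversal R

  class : Fin ρ → Fin m
  class c = inject≤ c ρ≤m

  class-of : Fin (ρ * m) → Fin ρ
  class-of e = proj₁ (Fin.remQuot m e)

  vertex′ : Fin ρ × Fin m → Fin 4 → Fin (n + ρ)
  vertex′ (c , b) zero    = n ↑ʳ c
  vertex′ (c , b) (suc l) = point (class c) b l ↑ˡ ρ

  vertex : Fin (ρ * m) → Fin 4 → Fin (n + ρ)
  vertex e = vertex′ (Fin.remQuot m e)

  ↑ˡ≢↑ʳ : ∀ {x : Fin n} {c : Fin ρ} → x ↑ˡ ρ ≢ n ↑ʳ c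
  ↑ˡ≢↑ʳ {x} {c} eq with () ← trans (sym (Fin.splitAt-↑ˡ n x ρ)) (trans (cong (Fin.splitAt n) eq) (Fin.splitAt-↑ʳ n ρ c))

  vertex′-injective : ∀ e {i j} → vertex′ e i ≡ vertex′ e j → i ≡ j
  vertex′-injective e {zero}  {zero}  eq = refl
  vertex′-injective e {zero}  {suc j} eq = contradiction (sym eq) ↑ˡ≢↑ʳ
  vertex′-injective e {suc i} {zero}  eq = contradiction eq ↑ˡ≢↑ʳ
  vertex′-injective e {suc i} {suc j} eq = cong suc (proj₂ (class-injective (↑ˡ-injective ρ _ _ eq)))

  same-class : ∀ {c c′ b b′ l l′} → c ≡ c′ →
    point (class c) b l ↑ˡ ρ ≡ point (class c′) b′ l′ ↑ˡ ρ → _≡_ {A = Fin ρ × Fin m} (c , b) (c′ , b′)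
  same-class refl eq = cong (_ ,_) (proj₁ (class-injective (↑ˡ-injective ρ _ _ eq)))

  -- Old and new points never coincide. A shared new point fixes the class, as do two shared old
  -- points by `linear`; a shared old point then fixes the block within the class.
  vertex′-linear : ∀ {e e′ i j i′ j′} → i ≢ j → vertex′ e i ≡ vertex′ e′ i′ → vertex′ e j ≡ vertex′ e′ j′ → e ≡ e′
  vertex′-linear {i = zero}  {zero}                    i≢j p q = contradiction refl i≢j
  vertex′-linear {i = zero}  {suc _} {suc _}           i≢j p q = contradiction (sym p) ↑ˡ≢↑ʳ
  vertex′-linear {i = zero}  {suc _} {zero}  {zero}    i≢j p q = contradiction q ↑ˡ≢↑ʳ
  vertex′-linear {i = zero}  {suc _} {zero}  {suc _}   i≢j p q = same-class (↑ʳ-injective n _ _ p) q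
  vertex′-linear {i = suc _} {zero}  {_}     {suc _}   i≢j p q = contradiction (sym q) ↑ˡ≢↑ʳ
  vertex′-linear {i = suc _} {zero}  {zero}  {zero}    i≢j p q = contradiction p ↑ˡ≢↑ʳ
  vertex′-linear {i = suc _} {zero}  {suc _} {zero}    i≢j p q = same-class (↑ʳ-injective n _ _ q) p
  vertex′-linear {i = suc _} {suc _} {zero}            i≢j p q = contradiction p ↑ˡ≢↑ʳ
  vertex′-linear {i = suc _} {suc _} {suc _} {zero}    i≢j p q = contradiction q ↑ˡ≢↑ʳ
  vertex′-linear {c , b} {c′ , b′} {suc i} {suc j} {suc i′} {suc j′} i≢j p q = same-class c≡c′ p
    where
    c≡c′ : c ≡ c′
    c≡c′ = inject≤-injective ρ≤m ρ≤m c c′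
      (linear (i≢j ∘ cong suc) (↑ˡ-injective ρ _ _ p) (↑ˡ-injective ρ _ _ q))

  remQuot-injective : ∀ {e e′ : Fin (ρ * m)} → Fin.remQuot m e ≡ Fin.remQuot m e′ → e ≡ e′
  remQuot-injective = Injection.injective (↔⇒↣ (*↔× {ρ} {m}))

  -- The four points of a single block are distinct; `1≤ρ` provides a class and `transversal` a
  -- block in it.
  4≤n+ρ : 4 ≤ n + ρ
  4≤n+ρ = injective⇒≤ (vertex′-injective (c₀ , transversal (class c₀)))
    where
    c₀ : Fin ρ
    c₀ = inject≤ zero 1≤ρ

  open LinearSpace vertex (from-yes (2 ≤? 4)) 4≤n+ρ (λ e → vertex′-injective (Fin.remQuot m e))
         (λ {_} {_} {i} {j} {i′} {j′} i≢j p q →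
           remQuot-injective (vertex′-linear {i = i} {j} {i′} {j′} i≢j p q)) public

  transversal-edge : Fin ρ → Fin (ρ * m)
  transversal-edge c = Fin.combine c (transversal (class c))

  vertex-transversal : ∀ c i → vertex (transversal-edge c) i ≡ vertex′ (c , transversal (class c)) i
  vertex-transversal c i = cong (λ e → vertex′ e i) (Fin.remQuot-combine c (transversal (class c)))

  transversal-disjoint : ∀ {c c′} → c ≢ c′ → Disjoint (block (transversal-edge c)) (block (transversal-edge c′))
  transversal-disjoint {c} {c′} c≢c′ (x , x∈)
    with x∈c , x∈c′ ← x∈p∩q⁻ _ _ x∈
    with i , x≡ ← ∈-image⁻ (vertex (transversal-edge c)) x∈c
       | j , x≡′ ← ∈-image⁻ (vertex (transversal-edge c′)) x∈c′
    = c≢c′ (equal i j (trans (sym (vertex-transversal c i)) (trans (sym x≡) (trans x≡′ (vertex-transversal c′ j)))))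
    where
    equal : ∀ i j → vertex′ (c , transversal (class c)) i ≡ vertex′ (c′ , transversal (class c′)) j → c ≡ c′
    equal zero    zero    eq = ↑ʳ-injective n _ _ eq
    equal zero    (suc j) eq = contradiction (sym eq) ↑ˡ≢↑ʳ
    equal (suc i) zero    eq = contradiction eq ↑ˡ≢↑ʳ
    equal (suc i) (suc j) eq = inject≤-injective ρ≤m ρ≤m c c′ (transversal-injective (↑ˡ-injective ρ _ _ eq))

  transversal-PPC : HasPPCOfSize packing ρ
  transversal-PPC = record
    { members  = map (block ∘ transversal-edge) (allFin ρ)
    ; unique   = Unique.map⁺ (λ eq → Fin.combine-injectiveˡ _ _ _ _ (block-injective eq)) (allFin⁺ ρ)
    ; subset   = All.map⁺ (All.universal (λ c → ∈-map⁺ block (∈-allFin (transversal-edge c))) (allFin ρ))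
    ; disjoint = AllPairs.map⁺ (AllPairs.map transversal-disjoint (allFin⁺ ρ))
    } , trans (length-map (block ∘ transversal-edge) (allFin ρ)) (length-tabulate {n = ρ} (λ c → c))

  -- Among more than ρ members, two come from the same class by the pigeonhole principle and share
  -- its new point, which contradicts disjointness.
  PPC-size≤ρ : (Q : PPC packing) → PPC.size Q ≤ ρ
  PPC-size≤ρ Q = ≮⇒≥ λ ρ<size →
    let i , j , i<j , eq = pigeonhole ρ<size (class-of ∘ edge)
    in AllPairs-lookup disjoint i<j
         (n ↑ʳ class-of (edge i) , x∈p∩q⁺ (∞∈ i , subst (λ c → n ↑ʳ c Subset.∈ lookup members j) (sym eq) (∞∈ j)))
    where
    open PPC Q
    member-block : ∀ i → ∃ λ e → e ∈ₗ allFin (ρ * m) × lookup members i ≡ block e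
    member-block i = ∈-map⁻ block (All.lookup subset (∈-lookup i))
    edge : Fin (length members) → Fin (ρ * m)
    edge i = proj₁ (member-block i)
    ∞∈ : ∀ i → n ↑ʳ class-of (edge i) Subset.∈ lookup members i
    ∞∈ i = subst (n ↑ʳ class-of (edge i) Subset.∈_) (sym (proj₂ (proj₂ (member-block i)))) (∈-image⁺ (vertex (edge i)) zero)

  completion : ∃ λ (P : Packing (n + ρ) 4) → length (blocks P) ≡ ρ * m × LargestPPCHasSize P ρ
  completion = packing , trans (length-map block (allFin (ρ * m))) (length-tabulate {n = ρ * m} (λ e → e)) ,
    transversal-PPC , λ (Q , size≡) → 1+n≰n (subst (_≤ ρ) size≡ (PPC-size≤ρ Q))

-- Passing from n to the odd number n / 3

n%6≡3⇒n≡3*odd : ∀ n → n % 6 ≡ 3 → n ≡ 3 * suc (n / 6 * 2)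
n%6≡3⇒n≡3*odd n n%6≡3 = trans (m≡m%n+[m/n]*n n 6) (trans (cong (_+ n / 6 * 6) n%6≡3) (regroup (n / 6)))
  where
  regroup : ∀ q → 3 + q * 6 ≡ 3 * suc (q * 2)
  regroup = solve-∀

theorem2p2 : (n : ℕ) → 1 ≤ n → n % 6 ≡ 3 →
    n ∉ 9 ∷ 15 ∷ 21 ∷ 141 ∷ 153 ∷ 165 ∷ 177 ∷ 189 ∷ 231 ∷ 249 ∷ 261 ∷ 285 ∷ 351 ∷ 357 ∷ [] →
    (ρ : ℕ) → 1 ≤ ρ → ρ ≤ n / 3 →
    ∃ λ (P : Packing (n + ρ) 4) → length (blocks P) ≡ ρ * (n / 3) × LargestPPCHasSize P ρ
theorem2p2 n _ n%6≡3 n∉ ρ 1≤ρ ρ≤n/3 =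
  Completion.completion (subst (λ v → ResolvableWithTransversal (Fin v) (Fin (n / 3)) (Fin (n / 3))) 3m≡n
    (odd⇒resolvable (n / 3) 2∤n/3 n/3≢3)) 1≤ρ ρ≤n/3
  where
  n/3≡odd : n / 3 ≡ suc (n / 6 * 2)
  n/3≡odd = trans (cong (_/ 3) (trans (n%6≡3⇒n≡3*odd n n%6≡3) (*-comm 3 (suc (n / 6 * 2)))))
                  (m*n/n≡m (suc (n / 6 * 2)) 3)
  3m≡n : 3 * (n / 3) ≡ n
  3m≡n = trans (cong (3 *_) n/3≡odd) (sym (n%6≡3⇒n≡3*odd n n%6≡3))
  2∤n/3 : ¬ 2 ∣ n / 3
  2∤n/3 2∣ = contradiction (∣1⇒≡1 (∣m+n∣m⇒∣n (subst (2 ∣_) (trans n/3≡odd (+-comm 1 (n / 6 * 2))) 2∣) (n∣m*n (n / 6)))) λ()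
  n/3≢3 : n / 3 ≢ 3
  -- Otherwise n would be 9, the first of the excluded values.
  n/3≢3 eq = n∉ (here (trans (sym 3m≡n) (cong (3 *_) eq)))
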